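{- $\displaystyle\lim_{n\to\infty} \frac{M(n)}{p(n)} = 0$.
   Context: $M(n)$ is the number of distinct values of the multinomial coefficients $n!/(\lambda_1!\cdots\lambda_r!)$ as $(\lambda_1,\dots,\lambda_r)$ ranges over all partitions of $n$; $p(n)$ is the number of partitions of $n$. -}

module Defs where

open import Data.Nat using (ℕ; zero; suc; _+_; _*_; _∸_; _⊓_; NonZero; _≟_)
open import Data.Nat.Properties using (_!≢0; m*n≢0)
open import Data.Nat.DivMod using (_/_)
open import Data.Nat.Combinatorics using ()
open import Data.Nat.Base using (_!)
open import Data.List using (List; []; _∷_; map; concatMap; length; deduplicate; upTo)
open import Data.Nat.ListAction using (product)
open import Data.Integer using (+_)
import Data.Rational as ℚ
open ℚ using (ℚ)

-- Partitions of n, as nonincreasing lists of positive parts summing to n.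
-- go f n k : all partitions of n with every part ≤ k (fuel f ≥ n suffices,
-- since each step removes a part of size ≥ 1).
partsGo : ℕ → ℕ → ℕ → List (List ℕ)
partsGo _       zero    k = [] ∷ []
partsGo zero    (suc n) k = []
partsGo (suc f) (suc n) k =
  concatMap (λ i → map (suc i ∷_) (partsGo f (suc n ∸ suc i) (suc i)))
            (upTo (suc n ⊓ k))

partitions : ℕ → List (List ℕ)
partitions n = partsGo n n n

p : ℕ → ℕ
p n = length (partitions n)

factProd : List ℕ → ℕ
factProd xs = product (map _! xs)

factProd≢0 : ∀ xs → NonZero (factProd xs)
factProd≢0 []       = _
factProd≢0 (x ∷ xs) = m*n≢0 (x !) (factProd xs) {{x !≢0}} {{factProd≢0 xs}}

multinomial : ℕ → List ℕ → ℕ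
multinomial n λs = _/_ (n !) (factProd λs) {{factProd≢0 λs}}

M : ℕ → ℕ
M n = length (deduplicate _≟_ (map (multinomial n) (partitions n)))

-- a / b as a rational number (b = 0 ↦ 0; only used with b = p n ≥ 1).
_÷_ : ℕ → ℕ → ℚ
m ÷ zero  = ℚ.0ℚ
m ÷ suc d = (+ m) ℚ./ suc d

{-# OPTIONS --safe #-}
module Submission where

-- Since 4! 1! 1! 1! = 3! 2! 2! and 4 + 1 + 1 + 1 = 3 + 2 + 2, every multinomial
-- coefficient of order n is attained at a partition with no part 4 or with at most two
-- parts 1.  So M(n) ≤ (p(n) - p(n-4)) + (p(n) - p(n-3)), a sum of seven values of
-- q(m) = p(m) - p(m-1), the number of partitions of m without 1s; it remains to see
-- that q = o(p).
--
-- Let r(m) count the partitions without 1s and 2s.  Those with a part ≥ 2c are at most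
-- a fraction 1/(c+1) of all partitions, because such a part can be replaced by c + 1
-- different collections of 1s and 2s, and its size is recovered as their sum.  Those
-- with all parts bounded are negligible because allowing parts 1 raises the order of
-- growth.  Hence r = o(p).  For q, partitions with at least c parts 2 are a fraction at
-- most 1/(c+1), as 2s can be turned into pairs of 1s, and those with fewer are counted
-- by c values of r.
--
-- Partitions are counted by generating functions, one factor 1/(1 - x^a) per allowed
-- part a; all bounds are uniform in the set of parts.

open import Defs
open import Algebra.Properties.CommutativeSemigroup as CommutativeSemigroupProperties using ()
import Data.Integer as ℤ
import Data.Integer.Properties as ℤ
open import Data.List using (List; []; _∷_; _++_; _∷ʳ_; concatMap; deduplicate; downFrom; foldr; length; map; upTo)
open import Data.List.Membership.Propositional using (_∈_; find)
open import Data.List.Membership.Propositional.Properties using (∈-++⁺ˡ; ∈-++⁺ʳ; ∈-++⁻; ∈-concatMap⁻; ∈-deduplicate⁻; ∈-map⁺; ∈-map⁻; ∈-upTo⁻; ∈-∃++)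
open import Data.List.Properties using (++-identityʳ; length-++; length-++-sucʳ; length-map; upTo-∷ʳ)
open import Data.List.Relation.Binary.Permutation.Propositional as Perm using (_↭_; prep; swap; module PermutationReasoning)
open import Data.List.Relation.Binary.Permutation.Propositional.Properties using (++-comm; ++⁺ˡ; shift; shifts)
open import Data.List.Relation.Unary.All as All using ()
open import Data.List.Relation.Unary.Any using (here; there)
open import Data.List.Relation.Unary.Unique.DecPropositional.Properties using (deduplicate-!)
open import Data.List.Relation.Unary.Unique.Propositional using (Unique; _∷_)
open import Data.Nat as ℕ using (ℕ; zero; suc; _+_; _*_; _∸_; _^_; _⊓_; _!; _≤_; z≤n; s≤s; _≟_; NonZero)
open import Data.Nat.DivMod using (_/_)
open import Data.Nat.Induction using (<-rec)
open import Data.Nat.Properties hiding (_≟_)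
open import Data.Nat.Tactic.RingSolver using (solve-∀)
open import Data.Product using (∃-syntax; _,_; _×_; proj₁; proj₂)
open import Data.Rational using (ℚ; 0ℚ; _<_; _-_; ∣_∣)
import Data.Rational as ℚ
import Data.Rational.Properties as ℚ
import Data.Rational.Unnormalised as ℚᵘ
import Data.Rational.Unnormalised.Properties as ℚᵘ
open import Data.Sum using (_⊎_; inj₁; inj₂)
open import Function using (_∘_)
open import Relation.Binary.PropositionalEquality using (_≡_; _≗_; refl; sym; trans; cong; cong₂; subst; subst₂; module ≡-Reasoning)
open import Relation.Nullary using (contradiction)

open CommutativeSemigroupProperties +-commutativeSemigroup using () renaming (x∙yz≈y∙xz to +-swapˡ; interchange to +-interchange)
open CommutativeSemigroupProperties *-commutativeSemigroup using () renaming (x∙yz≈y∙xz to *-swapˡ)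

-- Generating functions as recursive sequences.

-- adjoin a multiplies a generating function by 1/(1 - x^(a+1)), where a new part a + 1
-- acts on A by act a.  Throughout, parts are listed by their predecessors: enumerate as
-- runs over the partitions into parts a + 1 with a ∈ as.
module Adjoining {A : Set} (∅ unit : A) (_⊕_ : A → A → A) (act : ℕ → A → A) where

  -- `delay a f` is x^a times the series `f`. Unlike `f (n ∸ a)`, it is `∅` below index `a` instead
  -- of repeating `f 0`.
  delay : ℕ → (ℕ → A) → ℕ → A
  delay zero    f n       = f n
  delay (suc a) f zero    = ∅
  delay (suc a) f (suc n) = delay a f n

  -- The part a + 1 is used fewer than t times.
  adjoinUpTo : ℕ → ℕ → (ℕ → A) → ℕ → A
  adjoinUpTo zero    a f n = ∅
  adjoinUpTo (suc t) a f n = f n ⊕ act a (delay (suc a) (adjoinUpTo t a f) n)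

  adjoin : ℕ → (ℕ → A) → ℕ → A
  -- A part `a + 1` fits into `n` at most `n` times, so fewer than `suc n` uses is no restriction.
  adjoin a f n = adjoinUpTo (suc n) a f n

  atZero : ℕ → A
  atZero zero    = unit
  atZero (suc n) = ∅

  enumerate : List ℕ → ℕ → A
  enumerate = foldr adjoin atZero

  delay-cong-≤ : ∀ a {f g n} → (∀ i → i ≤ n → f i ≡ g i) → delay a f n ≡ delay a g n
  delay-cong-≤ zero            f≡g = f≡g _ ≤-refl
  delay-cong-≤ (suc a) {n = zero}  f≡g = refl
  delay-cong-≤ (suc a) {n = suc n} f≡g = delay-cong-≤ a λ i i≤n → f≡g i (m≤n⇒m≤1+n i≤n)

  delay-cong-< : ∀ a {f g n} → (∀ i → i ℕ.< n → f i ≡ g i) → delay (suc a) f n ≡ delay (suc a) g n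
  delay-cong-< a {n = zero}  f≡g = refl
  delay-cong-< a {n = suc n} f≡g = delay-cong-≤ a λ i i≤n → f≡g i (s≤s i≤n)

  delay-cong : ∀ a {f g} → f ≗ g → delay a f ≗ delay a g
  delay-cong a f≗g n = delay-cong-≤ a λ i _ → f≗g i

  delay-delay : ∀ a b f → delay a (delay b f) ≗ delay (a + b) f
  delay-delay zero    b f n       = refl
  delay-delay (suc a) b f zero    = refl
  delay-delay (suc a) b f (suc n) = delay-delay a b f n

  delay-comm : ∀ a b f → delay a (delay b f) ≗ delay b (delay a f)
  delay-comm a b f n = trans (delay-delay a b f n)
    (trans (cong (λ c → delay c f n) (+-comm a b)) (sym (delay-delay b a f n)))

  delay-+ : ∀ a f n → delay a f (a + n) ≡ f n
  delay-+ zero    f n = refl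
  delay-+ (suc a) f n = delay-+ a f n

  -- The recursion only looks back at strictly smaller indices, so it has one solution. The
  -- additivity and commutation identities below are proved by checking that both sides solve it.
  adjoinUpTo-unique : ∀ a {f h} → (∀ n → h n ≡ f n ⊕ act a (delay (suc a) h n)) →
                      ∀ t {n} → n ℕ.< t → h n ≡ adjoinUpTo t a f n
  adjoinUpTo-unique a {f} {h} eq (suc t) {n} n<1+t = trans (eq n)
    (cong (λ x → f n ⊕ act a x)
      (delay-cong-< a λ i i<n → adjoinUpTo-unique a eq t (<-≤-trans i<n (≤-pred n<1+t))))

  adjoin-unique : ∀ a {f h} → (∀ n → h n ≡ f n ⊕ act a (delay (suc a) h n)) → h ≗ adjoin a f
  adjoin-unique a eq n = adjoinUpTo-unique a eq (suc n) ≤-refl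

  adjoinUpTo-irrelevant : ∀ a f s t {n} → n ℕ.< s → n ℕ.< t → adjoinUpTo s a f n ≡ adjoinUpTo t a f n
  adjoinUpTo-irrelevant a f (suc s) (suc t) {n} n<1+s n<1+t = cong (λ x → f n ⊕ act a x)
    (delay-cong-< a λ i i<n → adjoinUpTo-irrelevant a f s t
      (<-≤-trans i<n (≤-pred n<1+s)) (<-≤-trans i<n (≤-pred n<1+t)))

  adjoin-unfold : ∀ a f n → adjoin a f n ≡ f n ⊕ act a (delay (suc a) (adjoin a f) n)
  adjoin-unfold a f n = cong (λ x → f n ⊕ act a x)
    (delay-cong-< a λ i i<n → adjoinUpTo-irrelevant a f n (suc i) i<n ≤-refl)

  adjoin-cong : ∀ a {f g} → f ≗ g → adjoin a f ≗ adjoin a g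
  adjoin-cong a {f} f≗g = adjoin-unique a λ n →
    trans (adjoin-unfold a f n) (cong (_⊕ act a (delay (suc a) (adjoin a f) n)) (f≗g n))

-- Counting series and the commutation of their factors.

open Adjoining 0 1 _+_ (λ _ m → m) renaming (enumerate to count)

delay-+-distrib : ∀ a f g n → delay a (λ i → f i + g i) n ≡ delay a f n + delay a g n
delay-+-distrib zero    f g n       = refl
delay-+-distrib (suc a) f g zero    = refl
delay-+-distrib (suc a) f g (suc n) = delay-+-distrib a f g n

adjoin-+-distrib : ∀ a f g n → adjoin a (λ i → f i + g i) n ≡ adjoin a f n + adjoin a g n
adjoin-+-distrib a f g n = sym (adjoin-unique a {h = λ i → F i + G i} step n)
  where
  F G : ℕ → ℕ
  F = adjoin a f
  G = adjoin a g
  step : ∀ i → F i + G i ≡ f i + g i + delay (suc a) (λ j → F j + G j) i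
  step i = begin
    F i + G i
      ≡⟨ cong₂ _+_ (adjoin-unfold a f i) (adjoin-unfold a g i) ⟩
    f i + delay (suc a) F i + (g i + delay (suc a) G i)
      ≡⟨ +-interchange (f i) (delay (suc a) F i) (g i) (delay (suc a) G i) ⟩
    f i + g i + (delay (suc a) F i + delay (suc a) G i)
      ≡⟨ cong (f i + g i +_) (delay-+-distrib (suc a) F G i) ⟨
    f i + g i + delay (suc a) (λ j → F j + G j) i ∎
    where open ≡-Reasoning

adjoin-delay : ∀ a b f → delay b (adjoin a f) ≗ adjoin a (delay b f)
adjoin-delay a b f = adjoin-unique a λ n → begin
  delay b (adjoin a f) n
    ≡⟨ delay-cong b (adjoin-unfold a f) n ⟩
  delay b (λ i → f i + delay (suc a) (adjoin a f) i) n
    ≡⟨ delay-+-distrib b f _ n ⟩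
  delay b f n + delay b (delay (suc a) (adjoin a f)) n
    ≡⟨ cong (delay b f n +_) (delay-comm b (suc a) (adjoin a f) n) ⟩
  delay b f n + delay (suc a) (delay b (adjoin a f)) n ∎
  where open ≡-Reasoning

-- Expanding the inner `adjoin b f` once shows that the left side solves the recursion that
-- characterises the right side.
adjoin-comm : ∀ a b f → adjoin a (adjoin b f) ≗ adjoin b (adjoin a f)
adjoin-comm a b f = adjoin-unique b λ n → begin
  adjoin a (adjoin b f) n
    ≡⟨ adjoin-cong a (adjoin-unfold b f) n ⟩
  adjoin a (λ i → f i + delay (suc b) (adjoin b f) i) n
    ≡⟨ adjoin-+-distrib a f _ n ⟩
  adjoin a f n + adjoin a (delay (suc b) (adjoin b f)) n
    ≡⟨ cong (adjoin a f n +_) (adjoin-delay a (suc b) (adjoin b f) n) ⟨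
  adjoin a f n + delay (suc b) (adjoin a (adjoin b f)) n ∎
  where open ≡-Reasoning

count-↭ : ∀ {as bs} → as ↭ bs → count as ≗ count bs
count-↭ Perm.refl                 n = refl
count-↭ (prep a as↭bs)            n = adjoin-cong a (count-↭ as↭bs) n
count-↭ (swap {xs = as} a b as↭bs) n = trans (adjoin-comm a b (count as) n)
  (adjoin-cong b (adjoin-cong a (count-↭ as↭bs)) n)
count-↭ (Perm.trans as↭bs bs↭cs)  n = trans (count-↭ as↭bs n) (count-↭ bs↭cs n)

-- Monotonicity and growth.

delay-mono : ∀ a {f g} → (∀ i → f i ≤ g i) → ∀ n → delay a f n ≤ delay a g n
delay-mono zero    f≤g n       = f≤g n
delay-mono (suc a) f≤g zero    = z≤n
delay-mono (suc a) f≤g (suc n) = delay-mono a f≤g n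

adjoin-mono : ∀ a {f g} → (∀ i → f i ≤ g i) → ∀ n → adjoin a f n ≤ adjoin a g n
adjoin-mono a {f} {g} f≤g n = go (suc n) n
  where
  go : ∀ t i → adjoinUpTo t a f i ≤ adjoinUpTo t a g i
  go zero    i = z≤n
  go (suc t) i = +-mono-≤ (f≤g i) (delay-mono (suc a) (go t) i)

adjoin-≥ : ∀ a f n → f n ≤ adjoin a f n
adjoin-≥ a f n = m≤m+n (f n) _

Monotone : (ℕ → ℕ) → Set
Monotone f = ∀ {m n} → m ≤ n → f m ≤ f n

partialSums-monotone : ∀ f → Monotone (adjoin 0 f)
partialSums-monotone f {m} {n} m≤n = subst (λ k → adjoin 0 f m ≤ adjoin 0 f k) (m∸n+n≡m m≤n) (go (n ∸ m))
  where
  go : ∀ k → adjoin 0 f m ≤ adjoin 0 f (k + m)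
  go zero    = ≤-refl
  go (suc k) = ≤-trans (go k)
    (≤-trans (m≤n+m _ (f (suc k + m))) (≤-reflexive (sym (adjoin-unfold 0 f (suc k + m)))))

-- The part `a + 1` can be used 0, ..., `c` times. What is left is always at least `n`, so each
-- choice contributes at least `h n`.
adjoin-monotone-* : ∀ a {h} → Monotone h → ∀ c n → suc c * h n ≤ adjoin a h (c * suc a + n)
adjoin-monotone-* a {h} mono zero    n = ≤-trans (≤-reflexive (*-identityˡ (h n))) (adjoin-≥ a h n)
adjoin-monotone-* a {h} mono (suc c) n = begin
  h n + suc c * h n
    ≤⟨ +-mono-≤ (mono (m≤n+m n (suc c * suc a))) (adjoin-monotone-* a mono c n) ⟩
  h (suc c * suc a + n) + adjoin a h (c * suc a + n)
    ≡⟨ cong (h (suc c * suc a + n) +_) (delay-+ (suc a) (adjoin a h) (c * suc a + n)) ⟨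
  h (suc c * suc a + n) + delay (suc a) (adjoin a h) (suc a + (c * suc a + n))
    ≡⟨ cong (λ i → h (suc c * suc a + n) + delay (suc a) (adjoin a h) i)
         (+-assoc (suc a) (c * suc a) n) ⟨
  h (suc c * suc a + n) + delay (suc a) (adjoin a h) (suc c * suc a + n)
    ≡⟨ adjoin-unfold a h (suc c * suc a + n) ⟨
  adjoin a h (suc c * suc a + n) ∎
  where open ≤-Reasoning

-- Partitions into parts from a fixed finite set.

-- f = o(f(0) + ⋯ + f(n)): adjoin 0 takes partial sums.
Negligible : (ℕ → ℕ) → Set
Negligible f = ∀ L → ∃[ N ] ∀ n → N ≤ n → L * f n ≤ adjoin 0 f n

delay-≤-+ : ∀ a {f g D n} → (∀ i → i ≤ n → f i ≤ g i + D) → delay a f n ≤ delay a g n + D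
delay-≤-+ zero                f≤g+D = f≤g+D _ ≤-refl
delay-≤-+ (suc a) {n = zero}  f≤g+D = z≤n
delay-≤-+ (suc a) {n = suc n} f≤g+D = delay-≤-+ a λ i i≤n → f≤g+D i (m≤n⇒m≤1+n i≤n)

delay-<-+ : ∀ a {f g D n} → (∀ i → i ℕ.< n → f i ≤ g i + D) → delay (suc a) f n ≤ delay (suc a) g n + D
delay-<-+ a {n = zero}  f≤g+D = z≤n
delay-<-+ a {n = suc n} f≤g+D = delay-≤-+ a λ i i≤n → f≤g+D i (s≤s i≤n)

delay-*ˡ : ∀ L a f n → L * delay a f n ≡ delay a (λ i → L * f i) n
delay-*ˡ L zero    f n       = refl
delay-*ˡ L (suc a) f zero    = *-zeroʳ L
delay-*ˡ L (suc a) f (suc n) = delay-*ˡ L a f n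

-- By `SF≗`, `SF n` is `adjoin 0 f n` plus `SF` at `n - (a + 1)`. From `N` on, the hypothesis bounds
-- the first summand and induction the second, so the error `D` is carried along without growing.
-- The unbounded `SF` finally absorbs it, which the factor 2 pays for.
adjoin-negligible : ∀ a {f} → 1 ≤ f 0 → Negligible f → Negligible (adjoin a f)
adjoin-negligible a {f} 1≤f0 neg L = N′ , bound
  where
  open ≤-Reasoning
  F SF : ℕ → ℕ
  F  = adjoin a f
  SF = adjoin 0 F
  N C D N′ : ℕ
  N  = neg (2 * L) .proj₁
  C  = SF N
  D  = 2 * L * C
  -- The partial sums of `f` are at least 1, so room for `D` parts `a + 1` makes `SF` at least
  -- `D + 1`.
  N′ = D * suc a

  SF≗ : SF ≗ adjoin a (adjoin 0 f)
  SF≗ = adjoin-comm 0 a f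

  upToConstant : ∀ n → 2 * L * F n ≤ SF n + D
  upToConstant = <-rec _ step
    where
    step : ∀ n → (∀ {i} → i ℕ.< n → 2 * L * F i ≤ SF i + D) → 2 * L * F n ≤ SF n + D
    step n ih with ≤-total n N
    -- Nothing is known about `f` here; `D` was chosen as the trivial bound for this initial
    -- segment.
    ... | inj₁ n≤N = begin
      2 * L * F n ≤⟨ *-monoʳ-≤ (2 * L) (≤-trans (adjoin-≥ 0 F n) (partialSums-monotone F n≤N)) ⟩
      D           ≤⟨ m≤n+m D (SF n) ⟩
      SF n + D    ∎
    ... | inj₂ N≤n = begin
      2 * L * F n
        ≡⟨ cong (2 * L *_) (adjoin-unfold a f n) ⟩
      2 * L * (f n + delay (suc a) F n)
        ≡⟨ *-distribˡ-+ (2 * L) (f n) _ ⟩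
      2 * L * f n + 2 * L * delay (suc a) F n
        ≡⟨ cong (2 * L * f n +_) (delay-*ˡ (2 * L) (suc a) F n) ⟩
      2 * L * f n + delay (suc a) (λ i → 2 * L * F i) n
        ≤⟨ +-mono-≤ (neg (2 * L) .proj₂ n N≤n) (delay-<-+ a λ i → ih {i}) ⟩
      adjoin 0 f n + (delay (suc a) SF n + D)
        ≡⟨ +-assoc (adjoin 0 f n) _ D ⟨
      adjoin 0 f n + delay (suc a) SF n + D
        ≡⟨ cong (λ x → adjoin 0 f n + x + D) (delay-cong (suc a) SF≗ n) ⟩
      adjoin 0 f n + delay (suc a) (adjoin a (adjoin 0 f)) n + D
        ≡⟨ cong (_+ D) (adjoin-unfold a (adjoin 0 f) n) ⟨
      adjoin a (adjoin 0 f) n + D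
        ≡⟨ cong (_+ D) (SF≗ n) ⟨
      SF n + D ∎

  D≤SF : ∀ n → N′ ≤ n → D ≤ SF n
  D≤SF n N′≤n = begin
    D                                             ≤⟨ n≤1+n D ⟩
    suc D                                         ≡⟨ *-identityʳ (suc D) ⟨
    suc D * 1
      ≤⟨ *-monoʳ-≤ (suc D) (≤-trans 1≤f0 (≤-trans (adjoin-≥ 0 f 0) (partialSums-monotone f z≤n))) ⟩
    suc D * adjoin 0 f (n ∸ N′)
      ≤⟨ adjoin-monotone-* a (partialSums-monotone f) D (n ∸ N′) ⟩
    adjoin a (adjoin 0 f) (D * suc a + (n ∸ N′))  ≡⟨ cong (adjoin a (adjoin 0 f)) (m+[n∸m]≡n N′≤n) ⟩
    adjoin a (adjoin 0 f) n                       ≡⟨ SF≗ n ⟨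
    SF n                                          ∎

  bound : ∀ n → N′ ≤ n → L * F n ≤ SF n
  bound n N′≤n = *-cancelˡ-≤ 2 (begin
    2 * (L * F n) ≡⟨ *-assoc 2 L (F n) ⟨
    2 * L * F n   ≤⟨ upToConstant n ⟩
    SF n + D      ≤⟨ +-monoʳ-≤ (SF n) (D≤SF n N′≤n) ⟩
    SF n + SF n   ≡⟨ cong (SF n +_) (+-identityʳ (SF n)) ⟨
    2 * SF n      ∎)

count-at-0 : ∀ as → count as 0 ≡ 1
count-at-0 []       = refl
count-at-0 (a ∷ as) = trans (+-identityʳ (count as 0)) (count-at-0 as)

-- The threshold depends on `as`. Uniformity is gained in `R-negligible`, which applies this to a
-- single bounded range of parts.
count-negligible : ∀ as → Negligible (count as)
count-negligible []       L = 1 , λ { (suc n) _ → ≤-trans (≤-reflexive (*-zeroʳ L)) z≤n }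
count-negligible (a ∷ as)   = adjoin-negligible a (≤-reflexive (sym (count-at-0 as))) (count-negligible as)

-- Partitions without 1s and 2s.

delay-cancelˡ : ∀ i a f n → delay (i + a) f (i + n) ≡ delay a f n
delay-cancelˡ zero    a f n = refl
delay-cancelˡ (suc i) a f n = delay-cancelˡ i a f n

sumOfDelays : ℕ → (ℕ → ℕ) → ℕ → ℕ
sumOfDelays zero    f n = 0
sumOfDelays (suc j) f n = sumOfDelays j f n + delay j f n

sumOfDelays-suc : ∀ j f n → sumOfDelays (suc j) f (suc n) ≡ f (suc n) + sumOfDelays j f n
sumOfDelays-suc zero    f n = sym (+-identityʳ (f (suc n)))
sumOfDelays-suc (suc j) f n = trans (cong (_+ delay j f n) (sumOfDelays-suc j f n))
  (+-assoc (f (suc n)) (sumOfDelays j f n) (delay j f n))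

sumOfDelays-zero : ∀ j f → sumOfDelays j f 0 ≤ f 0
sumOfDelays-zero zero          f = z≤n
sumOfDelays-zero (suc zero)    f = ≤-refl
sumOfDelays-zero (suc (suc j)) f =
  ≤-trans (≤-reflexive (+-identityʳ (sumOfDelays (suc j) f 0))) (sumOfDelays-zero (suc j) f)

-- The shifts 0, ..., `j - 1` reach distinct indices up to `n`, so no term of the partial sum is
-- used twice.
sumOfDelays≤partialSum : ∀ j f n → sumOfDelays j f n ≤ adjoin 0 f n
sumOfDelays≤partialSum j       f zero    = ≤-trans (sumOfDelays-zero j f) (adjoin-≥ 0 f 0)
sumOfDelays≤partialSum zero    f (suc n) = z≤n
sumOfDelays≤partialSum (suc j) f (suc n) = begin
  sumOfDelays (suc j) f (suc n)  ≡⟨ sumOfDelays-suc j f n ⟩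
  f (suc n) + sumOfDelays j f n  ≤⟨ +-monoʳ-≤ (f (suc n)) (sumOfDelays≤partialSum j f n) ⟩
  f (suc n) + adjoin 0 f n       ≡⟨ adjoin-unfold 0 f (suc n) ⟨
  adjoin 0 f (suc n)             ∎
  where open ≤-Reasoning

-- The parts 5, ..., `4 + j`. Parts up to 4 are kept apart because the trade singles them out; a
-- partition of `4 + j` has no part beyond this range.
from5 : ℕ → List ℕ
from5 zero    = []
from5 (suc j) = (4 + j) ∷ from5 j

from3 : ℕ → List ℕ
from3 j = from5 j ++ 3 ∷ 2 ∷ []

-- Partitions into parts from {3, …, 4 + j}, {2, …, 4 + j} and {1, …, 4 + j}.
R Q P : ℕ → ℕ → ℕ
R j = count (from3 j)
Q j = count (1 ∷ from3 j)
P j = count (0 ∷ 1 ∷ from3 j)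

R-mono : ∀ i k n → R i n ≤ R (k + i) n
R-mono i zero    n = ≤-refl
R-mono i (suc k) n = ≤-trans (R-mono i k n) (adjoin-≥ (4 + (k + i)) (R (k + i)) n)

-- Remove one part of size > 4 + i; the sum runs over its size.
R-largePart : ∀ i j k n → R (j + i) (i + n) ≤ R i (i + n) + sumOfDelays (5 + j) (R (k + (j + i))) n
R-largePart i zero    k n = m≤m+n (R i (i + n)) _
R-largePart i (suc j) k n = begin
  R (suc j + i) (i + n)
    ≡⟨ adjoin-unfold (4 + (j + i)) (R (j + i)) (i + n) ⟩
  R (j + i) (i + n) + delay (5 + (j + i)) (R (suc j + i)) (i + n)
    ≡⟨ cong (λ a → R (j + i) (i + n) + delay a (R (suc j + i)) (i + n)) (+-comm (5 + j) i) ⟩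
  R (j + i) (i + n) + delay (i + (5 + j)) (R (suc j + i)) (i + n)
    ≡⟨ cong (R (j + i) (i + n) +_) (delay-cancelˡ i (5 + j) (R (suc j + i)) n) ⟩
  R (j + i) (i + n) + delay (5 + j) (R (suc j + i)) n
    -- The slack `k` grows by one in the induction hypothesis, so that all summands refer to the
    -- same final range of parts.
    ≤⟨ +-mono-≤ (R-largePart i j (suc k) n) (delay-mono (5 + j) (R-mono (suc j + i) k) n) ⟩
  R i (i + n) + sumOfDelays (5 + j) (R (suc k + (j + i))) n + delay (5 + j) (R (k + (suc j + i))) n
    ≡⟨ cong (λ l → R i (i + n) + sumOfDelays (5 + j) (R l) n + delay (5 + j) (R (k + (suc j + i))) n)
         (+-suc k (j + i)) ⟨
  R i (i + n) + sumOfDelays (5 + j) (R (k + (suc j + i))) n + delay (5 + j) (R (k + (suc j + i))) n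
    ≡⟨ +-assoc (R i (i + n)) _ _ ⟩
  R i (i + n) + sumOfDelays (6 + j) (R (k + (suc j + i))) n ∎
  where open ≤-Reasoning

-- A partition of some `m ≤ n` without 1s and 2s is completed to one of `c * 2 + n` in at least
-- `c + 1` ways: take up to `c` parts 2 and fill up with 1s.
P-≥ : ∀ j c n → suc c * adjoin 0 (R j) n ≤ P j (c * 2 + n)
P-≥ j c n = ≤-trans (adjoin-monotone-* 1 (partialSums-monotone (R j)) c n)
  (≤-reflexive (adjoin-comm 1 0 (R j) (c * 2 + n)))

halve : ∀ L x y → suc (2 * L) * x ≤ y + y → L * x ≤ y
halve L x y le = *-cancelˡ-≤ 2 (begin
  2 * (L * x)      ≡⟨ *-assoc 2 L x ⟨
  2 * L * x        ≤⟨ *-monoˡ-≤ x (n≤1+n (2 * L)) ⟩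
  suc (2 * L) * x  ≤⟨ le ⟩
  y + y            ≡⟨ cong (y +_) (+-identityʳ y) ⟨
  2 * y            ∎)
  where open ≤-Reasoning

-- Cut at part size `4 + i`. Below the cut, the list `from3 i` gives a threshold free of `j`; above
-- it, a large part is removed and `P-≥` refills the space. Each kind costs one `P`, whence
-- `c = 2 * L` and `halve`.
R-negligible : ∀ L → ∃[ N ] ∀ j n → N ≤ j → N ≤ n → L * R j n ≤ P j n
R-negligible L = i + N , bound
  where
  open ≤-Reasoning
  c i N : ℕ
  c = 2 * L
  -- Removing a part larger than `i` from a partition of `i + n` frees exactly the room that `P-≥`
  -- needs for `c` parts 2.
  i = c * 2
  N = count-negligible (from3 i) (suc c) .proj₁

  core : ∀ j n → N ≤ i + n → suc c * R (j + i) (i + n) ≤ P (j + i) (i + n) + P (j + i) (i + n)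
  core j n N≤ = begin
    suc c * R (j + i) (i + n)
      ≤⟨ *-monoʳ-≤ (suc c) (≤-trans (R-largePart i j 0 n)
           (+-monoʳ-≤ (R i (i + n)) (sumOfDelays≤partialSum (5 + j) (R (j + i)) n))) ⟩
    suc c * (R i (i + n) + adjoin 0 (R (j + i)) n)
      ≡⟨ *-distribˡ-+ (suc c) (R i (i + n)) _ ⟩
    suc c * R i (i + n) + suc c * adjoin 0 (R (j + i)) n
      ≤⟨ +-mono-≤ (count-negligible (from3 i) (suc c) .proj₂ (i + n) N≤) (P-≥ (j + i) c n) ⟩
    adjoin 0 (R i) (i + n) + P (j + i) (i + n)
      ≤⟨ +-monoˡ-≤ _ (adjoin-mono 0 (λ m → ≤-trans (R-mono i j m) (adjoin-≥ 1 (R (j + i)) m)) (i + n)) ⟩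
    P (j + i) (i + n) + P (j + i) (i + n) ∎

  bound : ∀ j n → i + N ≤ j → i + N ≤ n → L * R j n ≤ P j n
  bound j n ≤j ≤n = halve L (R j n) (P j n) (subst₂ (λ k m → suc c * R k m ≤ P k m + P k m)
    (m∸n+n≡m (m+n≤o⇒m≤o i ≤j)) eq (core (j ∸ i) (n ∸ i) (subst (N ≤_) (sym eq) (m+n≤o⇒n≤o i ≤n))))
    where
    eq : i + (n ∸ i) ≡ n
    eq = m+[n∸m]≡n (m+n≤o⇒m≤o i ≤n)

-- Partitions without 1s.

adjoin1≤partialSum : ∀ f n → adjoin 1 f n ≤ adjoin 0 f n
adjoin1≤partialSum f = <-rec _ step
  where
  open ≤-Reasoning
  step : ∀ n → (∀ {i} → i ℕ.< n → adjoin 1 f i ≤ adjoin 0 f i) → adjoin 1 f n ≤ adjoin 0 f n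
  step zero          ih = ≤-refl
  step (suc zero)    ih = +-monoʳ-≤ (f 1) z≤n
  step (suc (suc n)) ih = begin
    adjoin 1 f (2 + n)             ≡⟨ adjoin-unfold 1 f (2 + n) ⟩
    f (2 + n) + adjoin 1 f n       ≤⟨ +-monoʳ-≤ (f (2 + n)) (ih (m≤n⇒m≤1+n ≤-refl)) ⟩
    f (2 + n) + adjoin 0 f n       ≤⟨ +-monoʳ-≤ (f (2 + n)) (partialSums-monotone f (n≤1+n n)) ⟩
    f (2 + n) + adjoin 0 f (1 + n) ≡⟨ adjoin-unfold 0 f (2 + n) ⟨
    adjoin 0 f (2 + n)             ∎

P-monotone : ∀ j → Monotone (P j)
P-monotone j = partialSums-monotone (Q j)

Q-negligible : ∀ L → ∃[ N ] ∀ j n → N ≤ j → N ≤ n → L * Q j n ≤ P j n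
Q-negligible L = c * 2 + N , bound
  where
  open ≤-Reasoning
  c K N : ℕ
  c = 2 * L
  -- One factor `suc c` is the gain wanted in `core`; the other is cancelled there against the `c`
  -- terms from partitions with few 2s.
  K = suc c * suc c
  N = R-negligible K .proj₁

  -- Peeling off 2s one at a time leaves the classes with exactly 0, ..., `b - 1` parts 2, each a
  -- value of `R` beyond the threshold. The rest have at least `b` parts 2 and become `Q j n` once
  -- `b` are removed.
  fewTwos : ∀ j n → N ≤ j → N ≤ n → ∀ b → K * Q j (b * 2 + n) ≤ b * P j (b * 2 + n) + K * Q j n
  fewTwos j n N≤j N≤n zero    = ≤-refl
  fewTwos j n N≤j N≤n (suc b) = begin
    K * Q j (2 + m)
      ≡⟨ cong (K *_) (adjoin-unfold 1 (R j) (2 + m)) ⟩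
    K * (R j (2 + m) + Q j m)
      ≡⟨ *-distribˡ-+ K (R j (2 + m)) (Q j m) ⟩
    K * R j (2 + m) + K * Q j m
      ≤⟨ +-mono-≤ (R-negligible K .proj₂ j (2 + m) N≤j (≤-trans N≤n (m≤n+m n (suc b * 2))))
           (fewTwos j n N≤j N≤n b) ⟩
    P j (2 + m) + (b * P j m + K * Q j n)
      ≤⟨ +-monoʳ-≤ (P j (2 + m)) (+-monoˡ-≤ (K * Q j n) (*-monoʳ-≤ b (P-monotone j (m≤n+m m 2)))) ⟩
    P j (2 + m) + (b * P j (2 + m) + K * Q j n)
      ≡⟨ +-assoc (P j (2 + m)) _ _ ⟨
    suc b * P j (2 + m) + K * Q j n ∎
    where
    m : ℕ
    m = b * 2 + n

  core : ∀ j n → N ≤ j → N ≤ n → suc c * Q j (c * 2 + n) ≤ P j (c * 2 + n) + P j (c * 2 + n)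
  core j n N≤j N≤n = *-cancelˡ-≤ (suc c) (begin
    suc c * (suc c * Q j m)
      ≡⟨ *-assoc (suc c) (suc c) (Q j m) ⟨
    K * Q j m
      ≤⟨ fewTwos j n N≤j N≤n c ⟩
    c * P j m + K * Q j n
      ≤⟨ +-mono-≤ (*-monoˡ-≤ (P j m) (n≤1+n c)) (≤-reflexive (*-assoc (suc c) (suc c) (Q j n))) ⟩
    suc c * P j m + suc c * (suc c * Q j n)
      ≤⟨ +-monoʳ-≤ (suc c * P j m) (*-monoʳ-≤ (suc c)
           (≤-trans (*-monoʳ-≤ (suc c) (adjoin1≤partialSum (R j) n)) (P-≥ j c n))) ⟩
    suc c * P j m + suc c * P j m
      ≡⟨ *-distribˡ-+ (suc c) (P j m) (P j m) ⟨
    suc c * (P j m + P j m) ∎)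
    where
    m : ℕ
    m = c * 2 + n

  bound : ∀ j n → c * 2 + N ≤ j → c * 2 + N ≤ n → L * Q j n ≤ P j n
  bound j n ≤j ≤n = halve L (Q j n) (P j n) (subst (λ m → suc c * Q j m ≤ P j m + P j m)
    (m+[n∸m]≡n (m+n≤o⇒m≤o (c * 2) ≤n)) (core j (n ∸ c * 2) (m+n≤o⇒n≤o (c * 2) ≤j) N≤))
    where
    N≤ : N ≤ n ∸ c * 2
    N≤ = ≤-trans (≤-reflexive (sym (m+n∸m≡n (c * 2) N))) (∸-monoˡ-≤ (c * 2) ≤n)

-- The partition function as a coefficient.

delay-<0 : ∀ {a n} f → n ℕ.< a → delay a f n ≡ 0
delay-<0 {suc a} {zero}  f n<a = refl
delay-<0 {suc a} {suc n} f n<a = delay-<0 f (≤-pred n<a)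

length-concatMap-∷ʳ : ∀ {A B : Set} (g : A → List B) xs x →
  length (concatMap g (xs ∷ʳ x)) ≡ length (concatMap g xs) + length (g x)
length-concatMap-∷ʳ g []       x = cong length (++-identityʳ (g x))
length-concatMap-∷ʳ g (y ∷ xs) x = begin
  length (g y ++ concatMap g (xs ∷ʳ x))
    ≡⟨ length-++ (g y) ⟩
  length (g y) + length (concatMap g (xs ∷ʳ x))
    ≡⟨ cong (length (g y) +_) (length-concatMap-∷ʳ g xs x) ⟩
  length (g y) + (length (concatMap g xs) + length (g x))
    ≡⟨ +-assoc (length (g y)) _ _ ⟨
  length (g y) + length (concatMap g xs) + length (g x)
    ≡⟨ cong (_+ length (g x)) (length-++ (g y)) ⟨
  length (concatMap g (y ∷ xs)) + length (g x) ∎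
  where open ≡-Reasoning

-- Raising the bound from `k` to `k + 1` appends one block, the partitions with largest part
-- `k + 1`. This is the delayed term of `adjoin-unfold`; both are empty when the part does not fit.
length-partsGo : ∀ f n k → n ≤ f → length (partsGo f n k) ≡ count (downFrom k) n
length-partsGo f       zero    k       n≤f = sym (count-at-0 (downFrom k))
length-partsGo (suc f) (suc n) zero    n≤f = refl
length-partsGo (suc f) (suc n) (suc k) n≤f = begin
  length (concatMap g (upTo (suc n ⊓ suc k)))
    ≡⟨ lastBlock (≤-<-connex k n) ⟩
  length (concatMap g (upTo (suc n ⊓ k))) + delay (suc k) (count (downFrom (suc k))) (suc n)
    ≡⟨ cong (_+ delay (suc k) (count (downFrom (suc k))) (suc n)) (length-partsGo (suc f) (suc n) k n≤f) ⟩
  count (downFrom k) (suc n) + delay (suc k) (count (downFrom (suc k))) (suc n)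
    ≡⟨ adjoin-unfold k (count (downFrom k)) (suc n) ⟨
  count (downFrom (suc k)) (suc n) ∎
  where
  open ≡-Reasoning
  g : ℕ → List (List ℕ)
  g i = map (suc i ∷_) (partsGo f (suc n ∸ suc i) (suc i))

  lastBlock : k ≤ n ⊎ n ℕ.< k → length (concatMap g (upTo (suc n ⊓ suc k))) ≡
    length (concatMap g (upTo (suc n ⊓ k))) + delay (suc k) (count (downFrom (suc k))) (suc n)
  lastBlock (inj₁ k≤n) = begin
    length (concatMap g (upTo (suc n ⊓ suc k)))
      ≡⟨ cong (length ∘ concatMap g ∘ upTo) (m≥n⇒m⊓n≡n (s≤s k≤n)) ⟩
    length (concatMap g (upTo (suc k)))
      ≡⟨ cong (length ∘ concatMap g) (upTo-∷ʳ k) ⟨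
    length (concatMap g (upTo k ∷ʳ k))
      ≡⟨ length-concatMap-∷ʳ g (upTo k) k ⟩
    length (concatMap g (upTo k)) + length (g k)
      ≡⟨ cong₂ _+_ (cong (length ∘ concatMap g ∘ upTo) (sym (m≥n⇒m⊓n≡n (m≤n⇒m≤1+n k≤n)))) (begin
           length (g k)
             ≡⟨ length-map (suc k ∷_) (partsGo f (n ∸ k) (suc k)) ⟩
           length (partsGo f (n ∸ k) (suc k))
             ≡⟨ length-partsGo f (n ∸ k) (suc k) (≤-trans (m∸n≤m n k) (≤-pred n≤f)) ⟩
           count (downFrom (suc k)) (n ∸ k)
             ≡⟨ delay-+ (suc k) (count (downFrom (suc k))) (n ∸ k) ⟨
           delay (suc k) (count (downFrom (suc k))) (suc k + (n ∸ k))
             ≡⟨ cong (delay k (count (downFrom (suc k)))) (m+[n∸m]≡n k≤n) ⟩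
           delay (suc k) (count (downFrom (suc k))) (suc n) ∎) ⟩
    length (concatMap g (upTo (suc n ⊓ k))) + delay (suc k) (count (downFrom (suc k))) (suc n) ∎
  lastBlock (inj₂ n<k) = begin
    length (concatMap g (upTo (suc n ⊓ suc k)))
      ≡⟨ cong (length ∘ concatMap g ∘ upTo) (trans (m≤n⇒m⊓n≡m (m≤n⇒m≤1+n n<k)) (sym (m≤n⇒m⊓n≡m n<k))) ⟩
    length (concatMap g (upTo (suc n ⊓ k)))
      ≡⟨ +-identityʳ _ ⟨
    length (concatMap g (upTo (suc n ⊓ k))) + 0
      ≡⟨ cong (length (concatMap g (upTo (suc n ⊓ k))) +_) (delay-<0 (count (downFrom (suc k))) (s≤s n<k)) ⟨
    length (concatMap g (upTo (suc n ⊓ k))) + delay (suc k) (count (downFrom (suc k))) (suc n) ∎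

without1And4 : ℕ → List ℕ
without1And4 j = from5 j ++ 2 ∷ 1 ∷ []

downFrom-from5 : ∀ j → downFrom (4 + j) ≡ from5 j ++ 3 ∷ 2 ∷ 1 ∷ 0 ∷ []
downFrom-from5 zero    = refl
downFrom-from5 (suc j) = cong ((4 + j) ∷_) (downFrom-from5 j)

downFrom-↭ : ∀ j → downFrom (4 + j) ↭ 0 ∷ 1 ∷ from3 j
downFrom-↭ j = begin
  downFrom (4 + j)               ≡⟨ downFrom-from5 j ⟩
  from5 j ++ 3 ∷ 2 ∷ 1 ∷ 0 ∷ []  ↭⟨ ++⁺ˡ (from5 j) (++-comm (3 ∷ 2 ∷ []) (1 ∷ 0 ∷ [])) ⟩
  from5 j ++ 1 ∷ 0 ∷ 3 ∷ 2 ∷ []  ↭⟨ shifts (from5 j) (1 ∷ 0 ∷ []) ⟩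
  1 ∷ 0 ∷ from3 j                ↭⟨ swap 1 0 Perm.refl ⟩
  0 ∷ 1 ∷ from3 j                ∎
  where open PermutationReasoning

without1-↭ : ∀ j → 3 ∷ without1And4 j ↭ 1 ∷ from3 j
without1-↭ j = begin
  3 ∷ from5 j ++ 2 ∷ 1 ∷ []  ↭⟨ shift 3 (from5 j) (2 ∷ 1 ∷ []) ⟨
  from5 j ++ 3 ∷ 2 ∷ 1 ∷ []  ↭⟨ ++⁺ˡ (from5 j) (++-comm (3 ∷ 2 ∷ []) (1 ∷ [])) ⟩
  from5 j ++ 1 ∷ 3 ∷ 2 ∷ []  ↭⟨ shift 1 (from5 j) (3 ∷ 2 ∷ []) ⟩
  1 ∷ from3 j                ∎
  where open PermutationReasoning

p≡P : ∀ {n} j → n ≡ 4 + j → p n ≡ P j n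
p≡P {n} j n≡4+j = begin
  p n                         ≡⟨ length-partsGo n n n ≤-refl ⟩
  count (downFrom n) n        ≡⟨ cong (λ k → count (downFrom k) n) n≡4+j ⟩
  count (downFrom (4 + j)) n  ≡⟨ count-↭ (downFrom-↭ j) n ⟩
  P j n                       ∎
  where open ≡-Reasoning

-- Factorial products of partitions.

-- The counting recursion with lists in place of numbers: each partition contributes its product of
-- factorials, with repetitions kept, so lengths give back `count`.
module Values = Adjoining [] (1 ∷ []) _++_ (λ a → map (suc a ! *_))
open Values using () renaming (enumerate to values)

length-delay : ∀ a f n → length (Values.delay a f n) ≡ delay a (length ∘ f) n
length-delay zero    f n       = refl
length-delay (suc a) f zero    = refl
length-delay (suc a) f (suc n) = length-delay a f n

length-adjoin : ∀ a f → length ∘ Values.adjoin a f ≗ adjoin a (length ∘ f)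
length-adjoin a f = adjoin-unique a λ n → begin
  length (Values.adjoin a f n)
    ≡⟨ cong length (Values.adjoin-unfold a f n) ⟩
  length (f n ++ map (suc a ! *_) (Values.delay (suc a) (Values.adjoin a f) n))
    ≡⟨ length-++ (f n) ⟩
  length (f n) + length (map (suc a ! *_) (Values.delay (suc a) (Values.adjoin a f) n))
    ≡⟨ cong (length (f n) +_) (length-map (suc a ! *_) (Values.delay (suc a) (Values.adjoin a f) n)) ⟩
  length (f n) + length (Values.delay (suc a) (Values.adjoin a f) n)
    ≡⟨ cong (length (f n) +_) (length-delay (suc a) (Values.adjoin a f) n) ⟩
  length (f n) + delay (suc a) (length ∘ Values.adjoin a f) n ∎
  where open ≡-Reasoning

length-values : ∀ as → length ∘ values as ≗ count as
length-values []       zero    = refl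
length-values []       (suc n) = refl
length-values (a ∷ as) n       =
  trans (length-adjoin a (values as) n) (adjoin-cong a (length-values as) n)

∈-delay⁻ : ∀ a f {n v} → v ∈ Values.delay a f n → ∃[ m ] (n ≡ a + m × v ∈ f m)
∈-delay⁻ zero    f {n}     v∈ = n , refl , v∈
∈-delay⁻ (suc a) f {suc n} v∈ with ∈-delay⁻ a f v∈
... | m , n≡a+m , v∈fm = m , cong suc n≡a+m , v∈fm

ClosedUnder : ℕ → (ℕ → List ℕ) → Set
ClosedUnder a f = ∀ {n v} → v ∈ f n → suc a ! * v ∈ f (suc a + n)

adjoin-closed-self : ∀ a f → ClosedUnder a (Values.adjoin a f)
adjoin-closed-self a f {n} {v} v∈ = subst (suc a ! * v ∈_) (sym (Values.adjoin-unfold a f (suc a + n)))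
  (∈-++⁺ʳ (f (suc a + n)) (∈-map⁺ (suc a ! *_)
    (subst (v ∈_) (sym (Values.delay-+ (suc a) (Values.adjoin a f) n)) v∈)))

-- If a part `a + 1` was used last, it is taken off, the part `b + 1` is inserted into the smaller
-- partition, and `a + 1` is put back. Insertion thus does not depend on the order in which parts
-- were adjoined.
adjoin-closed : ∀ a b f → ClosedUnder b f → ClosedUnder b (Values.adjoin a f)
adjoin-closed a b f closed {n} {v} v∈ = <-rec (λ n → ∀ v → v ∈ F n → suc b ! * v ∈ F (suc b + n)) step n v v∈
  where
  F : ℕ → List ℕ
  F = Values.adjoin a f
  step : ∀ n → (∀ {m} → m ℕ.< n → ∀ v → v ∈ F m → suc b ! * v ∈ F (suc b + m)) →
         ∀ v → v ∈ F n → suc b ! * v ∈ F (suc b + n)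
  step n ih v v∈ with ∈-++⁻ (f n) (subst (v ∈_) (Values.adjoin-unfold a f n) v∈)
  ... | inj₁ v∈f = ∈-++⁺ˡ (closed v∈f)
  ... | inj₂ v∈map with ∈-map⁻ (suc a ! *_) v∈map
  ...   | u , u∈ , refl with ∈-delay⁻ (suc a) F {n} u∈
  ...     | m , refl , u∈F = subst₂ (λ x i → x ∈ F i)
    (*-swapˡ (suc a !) (suc b !) u)
    (+-swapˡ (suc a) (suc b) m)
    (adjoin-closed-self a f (ih (s≤s (m≤n+m m a)) u u∈F))

values-closed : ∀ {a} as → a ∈ as → ClosedUnder a (values as)
values-closed (a ∷ as) (here refl)  = adjoin-closed-self a (values as)
values-closed (b ∷ as) (there a∈as) = adjoin-closed b _ (values as) (values-closed as a∈as)

1∈values-0 : ∀ as → 1 ∈ values as 0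
1∈values-0 []       = here refl
1∈values-0 (a ∷ as) = ∈-++⁺ˡ (1∈values-0 as)

-- Trading parts at constant sum and factorial product.

∈-from5 : ∀ {j i} → i ℕ.< j → 4 + i ∈ from5 j
∈-from5 {suc j} i<1+j with m≤n⇒m<n∨m≡n (≤-pred i<1+j)
... | inj₁ i<j  = there (∈-from5 i<j)
... | inj₂ refl = here refl

-- A partition of n with factorial product v: `fours` fours, `ones` ones, and other
-- parts of sum m and factorial product u.
data Split (j : ℕ) : ℕ → ℕ → Set where
  split : ∀ fours ones {m u} → u ∈ values (without1And4 j) m →
          Split j (ones + (fours * 4 + m)) (24 ^ fours * u)

split-∷-other : ∀ {j n v i} → i ∈ without1And4 j → Split j n v → Split j (suc i + n) (suc i ! * v)
split-∷-other {j} {i = i} i∈ (split a d {m} {u} u∈) = subst₂ (Split j)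
  (trans (cong (d +_) (+-swapˡ (a * 4) (suc i) m)) (+-swapˡ d (suc i) (a * 4 + m)))
  (*-swapˡ (24 ^ a) (suc i !) u)
  (split a d (values-closed (without1And4 j) i∈ u∈))

split-∷ : ∀ {j n v} i → i ℕ.< 4 + j → Split j n v → Split j (suc i + n) (suc i ! * v)
-- `i` is the predecessor of the part: `0` adds a one, with factor 1, `3` adds a four, with factor
-- 4! = 24, and all others join the remainder.
split-∷ {j} 0 _ (split a d {m} {u} u∈) =
  subst (Split j _) (sym (*-identityˡ (24 ^ a * u))) (split a (suc d) u∈)
split-∷ {j} 1 _ = split-∷-other (∈-++⁺ʳ (from5 j) (there (here refl)))
split-∷ {j} 2 _ = split-∷-other (∈-++⁺ʳ (from5 j) (here refl))
split-∷ {j} 3 _ (split a d {m} {u} u∈) = subst₂ (Split j)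
  (+-swapˡ d 4 (a * 4 + m)) (*-assoc 24 (24 ^ a) u) (split (suc a) d u∈)
split-∷ (suc (suc (suc (suc i)))) i<4+j =
  split-∷-other (∈-++⁺ˡ (∈-from5 (≤-pred (≤-pred (≤-pred (≤-pred i<4+j))))))

partition-split : ∀ j f n k {xs} → n ≤ 4 + j → xs ∈ partsGo f n k → Split j n (factProd xs)
partition-split j f       zero    k n≤ (here refl) = split 0 0 (1∈values-0 (without1And4 j))
partition-split j (suc f) (suc n) k n≤ xs∈
  with i , i∈ , xs∈map ← find (∈-concatMap⁻ _ {xs = upTo (suc n ⊓ k)} xs∈)
  with ys , ys∈ , refl ← ∈-map⁻ (suc i ∷_) xs∈map
  = subst (λ m → Split j m (factProd (suc i ∷ ys))) (cong suc (m+[n∸m]≡n (≤-pred i<1+n)))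
      (split-∷ i (<-≤-trans i<1+n n≤)
        (partition-split j f (n ∸ i) (suc i) (≤-trans (m∸n≤m n i) (≤-trans (n≤1+n n) n≤)) ys∈))
  where
  i<1+n : i ℕ.< suc n
  i<1+n = <-≤-trans (∈-upTo⁻ i∈) (m⊓n≤m (suc n) k)

-- Factorial products of the partitions with no part 4, or with zero, one or two parts 1.
candidates : ℕ → ℕ → List ℕ
candidates j n = values (0 ∷ without1And4 j) n ++ V n ++ V (n ∸ 1) ++ V (n ∸ 2)
  where
  V : ℕ → List ℕ
  V = values (3 ∷ without1And4 j)

ones∈values : ∀ as {m u} d → u ∈ values (0 ∷ as) m → u ∈ values (0 ∷ as) (d + m)
ones∈values as         zero    u∈ = u∈
ones∈values as {m} {u} (suc d) u∈ = subst (_∈ values (0 ∷ as) (suc d + m)) (*-identityˡ u)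
  (adjoin-closed-self 0 (values as) (ones∈values as d u∈))

fours∈values : ∀ as {m u} a → u ∈ values (3 ∷ as) m → 24 ^ a * u ∈ values (3 ∷ as) (a * 4 + m)
fours∈values as {m} {u} zero    u∈ = subst (_∈ values (3 ∷ as) m) (sym (*-identityˡ u)) u∈
fours∈values as {m} {u} (suc a) u∈ = subst (_∈ values (3 ∷ as) (suc a * 4 + m)) (sym (*-assoc 24 (24 ^ a) u))
  (adjoin-closed-self 3 (values as) (fours∈values as a u∈))

-- Trading 4 + 1 + 1 + 1 for 3 + 2 + 2 changes neither the sum nor the product of factorials.
split∈candidates : ∀ j a d {m u} → u ∈ values (without1And4 j) m →
                   24 ^ a * u ∈ candidates j (d + (a * 4 + m))
split∈candidates j zero d {m} {u} u∈ = ∈-++⁺ˡ (subst (_∈ values (0 ∷ without1And4 j) (d + m))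
  (sym (*-identityˡ u)) (ones∈values (without1And4 j) d (∈-++⁺ˡ u∈)))
-- Ones contribute the factor 1, so dropping all `d` of them keeps the product and leaves a
-- partition of `n - d` without 1s; this is where `V n`, `V (n ∸ 1)` and `V (n ∸ 2)` come from.
split∈candidates j a@(suc _) 0 {m} u∈ = ∈-++⁺ʳ (values (0 ∷ without1And4 j) _)
  (∈-++⁺ˡ (fours∈values (without1And4 j) a (∈-++⁺ˡ u∈)))
split∈candidates j a@(suc _) 1 {m} u∈ = ∈-++⁺ʳ (values (0 ∷ without1And4 j) _)
  (∈-++⁺ʳ (values (3 ∷ without1And4 j) (1 + (a * 4 + m)))
    (∈-++⁺ˡ (fours∈values (without1And4 j) a (∈-++⁺ˡ u∈))))
split∈candidates j a@(suc _) 2 {m} u∈ = ∈-++⁺ʳ (values (0 ∷ without1And4 j) _)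
  (∈-++⁺ʳ (values (3 ∷ without1And4 j) (2 + (a * 4 + m)))
    (∈-++⁺ʳ (values (3 ∷ without1And4 j) (1 + (a * 4 + m)))
      (fours∈values (without1And4 j) a (∈-++⁺ˡ u∈))))
split∈candidates j (suc a) (suc (suc (suc d))) {m} {u} u∈ =
  subst₂ (λ v n → v ∈ candidates j n) (product-eq (24 ^ a) u) (sum-eq a d m)
    -- The number of fours drops with every trade, so trading stops with no fours or at most two
    -- ones left.
    (split∈candidates j a d (insert 2∈ (insert 1∈ (insert 1∈ u∈))))
  where
  insert : ∀ {i} → i ∈ without1And4 j → ClosedUnder i (values (without1And4 j))
  insert = values-closed (without1And4 j)
  2∈ : 2 ∈ without1And4 j
  2∈ = ∈-++⁺ʳ (from5 j) (here refl)
  1∈ : 1 ∈ without1And4 j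
  1∈ = ∈-++⁺ʳ (from5 j) (there (here refl))
  product-eq : ∀ x u → x * (6 * (2 * (2 * u))) ≡ 24 * x * u
  product-eq = solve-∀
  sum-eq : ∀ a d m → d + (a * 4 + (7 + m)) ≡ 3 + d + (4 + a * 4 + m)
  sum-eq = solve-∀

-- Bounding M by seven values of q.

unique-⊆⇒length≤ : ∀ {A : Set} {xs ys : List A} → Unique xs → (∀ {z} → z ∈ xs → z ∈ ys) →
                   length xs ≤ length ys
unique-⊆⇒length≤ {xs = []}     _          xs⊆ys = z≤n
unique-⊆⇒length≤ {xs = x ∷ xs} (x∉ ∷ xs!) xs⊆ys with ∈-∃++ (xs⊆ys (here refl))
... | as , bs , refl = ≤-trans (s≤s (unique-⊆⇒length≤ xs! xs⊆as++bs))
  (≤-reflexive (sym (length-++-sucʳ as x bs)))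
  where
  xs⊆as++bs : ∀ {z} → z ∈ xs → z ∈ as ++ bs
  xs⊆as++bs z∈ with ∈-++⁻ as (xs⊆ys (there z∈))
  ... | inj₁ z∈as         = ∈-++⁺ˡ z∈as
  ... | inj₂ (here refl)  = contradiction refl (All.lookup x∉ z∈)
  ... | inj₂ (there z∈bs) = ∈-++⁺ʳ as z∈bs

-- n! / v, with the junk value 0 at v = 0.
quotient! : ℕ → ℕ → ℕ
quotient! n zero    = 0
quotient! n (suc v) = n ! / suc v

multinomial≡quotient! : ∀ n xs → multinomial n xs ≡ quotient! n (factProd xs)
multinomial≡quotient! n xs = go (factProd xs) {{factProd≢0 xs}}
  where
  go : ∀ v .{{_ : NonZero v}} → n ! / v ≡ quotient! n v
  go (suc v) = refl

-- A multinomial coefficient depends only on the factorial product, so every value lies in the image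
-- of `candidates` under `quotient! n`. Repetitions there only weaken the bound.
M≤length-candidates : ∀ {n} j → n ≡ 4 + j → M n ≤ length (candidates j n)
M≤length-candidates {n} j n≡4+j = ≤-trans
  (unique-⊆⇒length≤ (deduplicate-! _≟_ (map (multinomial n) (partitions n))) attained)
  (≤-reflexive (length-map (quotient! n) (candidates j n)))
  where
  factProd∈ : ∀ {m v} → Split j m v → v ∈ candidates j m
  factProd∈ (split a d u∈) = split∈candidates j a d u∈
  attained : ∀ {z} → z ∈ deduplicate _≟_ (map (multinomial n) (partitions n)) →
             z ∈ map (quotient! n) (candidates j n)
  attained z∈ with ∈-map⁻ (multinomial n) (∈-deduplicate⁻ _≟_ (map (multinomial n) (partitions n)) z∈)
  ... | xs , xs∈ , refl = subst (_∈ map (quotient! n) (candidates j n)) (sym (multinomial≡quotient! n xs))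
    (∈-map⁺ (quotient! n) (factProd∈ (partition-split j n n n (≤-reflexive n≡4+j) xs∈)))

P-suc : ∀ j n → P j (suc n) ≡ Q j (suc n) + P j n
P-suc j n = adjoin-unfold 0 (Q j) (suc n)

-- This is p(m) - p(m-4) telescoped through p(m) - p(m-1) = q(m). Adding `P j n` to both sides
-- avoids subtraction.
without4 : ∀ j n → count (0 ∷ without1And4 j) (4 + n) ≡
           Q j (4 + n) + (Q j (3 + n) + (Q j (2 + n) + Q j (1 + n)))
without4 j n = +-cancelʳ-≡ (P j n) _ _ (begin
  count (0 ∷ without1And4 j) (4 + n) + P j n
    ≡⟨ cong (count (0 ∷ without1And4 j) (4 + n) +_) (P≗ n) ⟩
  count (0 ∷ without1And4 j) (4 + n) + count (3 ∷ 0 ∷ without1And4 j) n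
    ≡⟨ adjoin-unfold 3 (count (0 ∷ without1And4 j)) (4 + n) ⟨
  count (3 ∷ 0 ∷ without1And4 j) (4 + n)
    ≡⟨ P≗ (4 + n) ⟨
  P j (4 + n)
    ≡⟨ trans (P-suc j (3 + n)) (cong (Q j (4 + n) +_)
      (trans (P-suc j (2 + n)) (cong (Q j (3 + n) +_)
      (trans (P-suc j (1 + n)) (cong (Q j (2 + n) +_) (P-suc j n)))))) ⟩
  Q j (4 + n) + (Q j (3 + n) + (Q j (2 + n) + (Q j (1 + n) + P j n)))
    ≡⟨ assoc (Q j (4 + n)) (Q j (3 + n)) (Q j (2 + n)) (Q j (1 + n)) (P j n) ⟩
  Q j (4 + n) + (Q j (3 + n) + (Q j (2 + n) + Q j (1 + n))) + P j n ∎)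
  where
  open ≡-Reasoning
  P≗ : P j ≗ count (3 ∷ 0 ∷ without1And4 j)
  P≗ = count-↭ (Perm.trans (prep 0 (Perm.↭-sym (without1-↭ j))) (swap 0 3 Perm.refl))
  assoc : ∀ a b c d e → a + (b + (c + (d + e))) ≡ a + (b + (c + d)) + e
  assoc = solve-∀

length-candidates : ∀ j n → length (candidates j (4 + n)) ≡
  Q j (4 + n) + (Q j (3 + n) + (Q j (2 + n) + Q j (1 + n))) + (Q j (4 + n) + (Q j (3 + n) + Q j (2 + n)))
length-candidates j n = begin
  length (candidates j (4 + n))
    ≡⟨ length-++ (values (0 ∷ without1And4 j) (4 + n)) ⟩
  length (values (0 ∷ without1And4 j) (4 + n)) + length (V (4 + n) ++ V (3 + n) ++ V (2 + n))
    ≡⟨ cong₂ _+_ (trans (length-values (0 ∷ without1And4 j) (4 + n)) (without4 j n))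
         (trans (length-++ (V (4 + n))) (cong₂ _+_ (V-length (4 + n))
           (trans (length-++ (V (3 + n))) (cong₂ _+_ (V-length (3 + n)) (V-length (2 + n)))))) ⟩
  Q j (4 + n) + (Q j (3 + n) + (Q j (2 + n) + Q j (1 + n))) + (Q j (4 + n) + (Q j (3 + n) + Q j (2 + n))) ∎
  where
  open ≡-Reasoning
  V : ℕ → List ℕ
  V = values (3 ∷ without1And4 j)
  V-length : ∀ m → length (V m) ≡ Q j m
  V-length m = trans (length-values (3 ∷ without1And4 j) m) (count-↭ (without1-↭ j) m)

seven-terms : ∀ L {m q₁ q₂ q₃ q₄ b} → m ≤ q₄ + (q₃ + (q₂ + q₁)) + (q₄ + (q₃ + q₂)) →
  7 * L * q₁ ≤ b → 7 * L * q₂ ≤ b → 7 * L * q₃ ≤ b → 7 * L * q₄ ≤ b → L * m ≤ b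
seven-terms L {m} {q₁} {q₂} {q₃} {q₄} {b} m≤ q₁≤ q₂≤ q₃≤ q₄≤ = *-cancelˡ-≤ 7 (begin
  7 * (L * m)
    ≡⟨ *-assoc 7 L m ⟨
  7 * L * m
    ≤⟨ *-monoʳ-≤ (7 * L) m≤ ⟩
  7 * L * (q₄ + (q₃ + (q₂ + q₁)) + (q₄ + (q₃ + q₂)))
    ≡⟨ distrib (7 * L) q₄ q₃ q₂ q₁ ⟩
  2 * (7 * L * q₄) + 2 * (7 * L * q₃) + 2 * (7 * L * q₂) + 7 * L * q₁
    ≤⟨ +-mono-≤ (+-mono-≤ (+-mono-≤ (*-monoʳ-≤ 2 q₄≤) (*-monoʳ-≤ 2 q₃≤)) (*-monoʳ-≤ 2 q₂≤)) q₁≤ ⟩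
  2 * b + 2 * b + 2 * b + b
    ≡⟨ collect b ⟩
  7 * b ∎)
  where
  open ≤-Reasoning
  distrib : ∀ l a b c d → l * (a + (b + (c + d)) + (a + (b + c))) ≡
            2 * (l * a) + 2 * (l * b) + 2 * (l * c) + l * d
  distrib = solve-∀
  collect : ∀ x → 2 * x + 2 * x + 2 * x + x ≡ 7 * x
  collect = solve-∀

-- The range parameter `j = n - 4` grows with `n`, which is why the bound on `Q` had to be uniform
-- in `j`.
M-negligible : ∀ L → ∃[ N ] ∀ n → N ≤ n → L * M n ≤ p n
M-negligible L = 4 + N , λ n N≤n → bound n (n ∸ 4) (sym (m+[n∸m]≡n (m+n≤o⇒m≤o 4 N≤n)))
    (≤-trans (≤-reflexive (sym (m+n∸m≡n 4 N))) (∸-monoˡ-≤ 4 N≤n))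
  where
  N : ℕ
  N = Q-negligible (7 * L) .proj₁
  bound : ∀ n j → n ≡ 4 + j → N ≤ j → L * M n ≤ p n
  bound n j n≡4+j N≤j = subst (L * M n ≤_) (sym (p≡P j n≡4+j))
    (seven-terms L (≤-trans (M≤length-candidates j n≡4+j) (≤-reflexive
        (trans (cong (length ∘ candidates j) n≡4+j) (length-candidates j j))))
      (Q≤ 1 (s≤s z≤n)) (Q≤ 2 (s≤s (s≤s z≤n))) (Q≤ 3 (n≤1+n 3)) (Q≤ 4 ≤-refl))
    where
    Q≤ : ∀ i → i ≤ 4 → 7 * L * Q j (i + j) ≤ P j n
    Q≤ i i≤4 = ≤-trans (Q-negligible (7 * L) .proj₂ j (i + j) N≤j (≤-trans N≤j (m≤n+m j i)))
      (P-monotone j (subst (i + j ≤_) (sym n≡4+j) (+-monoˡ-≤ j i≤4)))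

-- From natural-number bounds to rational ε.

÷-nonNegative : ∀ m k → 0ℚ ℚ.≤ m ÷ k
÷-nonNegative m zero    = ℚ.≤-refl
÷-nonNegative m (suc d) = ℚ.nonNegative⁻¹ (m ÷ suc d) {{ℚ.normalize-nonNeg m (suc d)}}

-- A positive rational is at least the reciprocal of its denominator; the extra successor makes the
-- inequality strict.
÷-< : ∀ ε → 0ℚ < ε → ∀ {m k} → suc (ℚ.↧ₙ ε) * m ≤ k → m ÷ k < ε
-- Here `m ÷ zero` is 0 by convention.
÷-< ε 0<ε {m} {zero}  _   = 0<ε
÷-< ε 0<ε {m} {suc d} m≤k with ε | ℚ.drop-*<* 0<ε
... | ℚ.mkℚ (ℤ.+ zero)   e _ | ℤ.+<+ ()
... | ℚ.mkℚ (ℤ.+ suc a)  e _ | _ = ℚ.toℚᵘ-cancel-< (ℚᵘ.<-respˡ-≃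
  (ℚᵘ.≃-sym (ℚ.toℚᵘ-fromℚᵘ (ℚᵘ.mkℚᵘ (ℤ.+ m) d))) (ℚᵘ.*<* (ℤ.+◃-mono-< (begin-strict
    m * suc e      ≡⟨ *-comm m (suc e) ⟩
    suc e * m      <⟨ strictly m m≤k ⟩
    suc d          ≤⟨ m≤m+n (suc d) (a * suc d) ⟩
    suc a * suc d  ∎))))
  where
  open ≤-Reasoning
  strictly : ∀ m → suc (suc e) * m ≤ suc d → suc e * m ℕ.< suc d
  strictly zero    _  = subst (ℕ._< suc d) (sym (*-zeroʳ e)) (s≤s z≤n)
  strictly (suc m) le = <-≤-trans (s≤s (m≤n+m (suc e * suc m) m)) le

theorem8 : (ε : ℚ) → 0ℚ < ε → ∃[ N ] ((n : ℕ) → N ≤ n → ∣ (M n ÷ p n) - 0ℚ ∣ < ε)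
theorem8 ε 0<ε = proj₁ negligible , λ n N≤n → subst (_< ε) (sym (begin
  ∣ (M n ÷ p n) - 0ℚ ∣  ≡⟨ cong ∣_∣ (ℚ.+-identityʳ (M n ÷ p n)) ⟩
  ∣ M n ÷ p n ∣         ≡⟨ ℚ.0≤p⇒∣p∣≡p (÷-nonNegative (M n) (p n)) ⟩
  M n ÷ p n             ∎)) (÷-< ε 0<ε (proj₂ negligible n N≤n))
  where
  open ≡-Reasoning
  negligible : ∃[ N ] ∀ n → N ≤ n → suc (ℚ.↧ₙ ε) * M n ≤ p n
  negligible = M-negligible (suc (ℚ.↧ₙ ε))
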